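{- Let $G$ be a connected $k$-regular graph that admits an MCSD. Then $G$ has a Hamiltonian cycle.
   Context: Graphs are finite, undirected, without multiple edges or self-loops; $n$ is the number of vertices of $G$. An edge labeling $\lambda$ of $G$ assigns to every edge $uv$ two labels, $\lambda_u(uv)$ corresponding to $u$ and $\lambda_v(uv)$ corresponding to $v$. It is a chordal sense of direction (CSD) if there is a cyclic ordering of the vertices, i.e. a bijection $r:V(G)\to\{0,\ldots,n-1\}$ (the rank), such that for every edge $uv$ the label $\lambda_u(uv)\in\{1,\ldots,n-1\}$ equals $r(v)-r(u)$ modulo $n$ (and likewise $\lambda_v(uv)$ equals $r(u)-r(v)$ modulo $n$). It is a minimal chordal sense of direction (MCSD) if moreover the total number of distinct labels used is exactly $\Delta(G)$, the maximum degree of $G$; thus for $k$-regular $G$ exactly $k$ labels are used. $G$ admits an MCSD if some labeling of $G$ is an MCSD.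
   Formalization: The graph is assumed to have at least 3 vertices: the graphs with one vertex and with two adjacent vertices are connected, regular and admit an MCSD, but have no Hamiltonian cycle. -}

module Defs where

open import Data.Bool.Base using (Bool; T)
open import Data.Bool.Properties using (T?)
open import Data.Fin.Base using (Fin; zero; suc; toℕ; inject₁; fromℕ)
open import Data.Integer.Base using (+_; _-_)
open import Data.Integer.Divisibility using (_∣_)
open import Data.List.Base using (List; length; filter; map; allFin)
open import Data.List.Extrema.Nat using (max)
open import Data.List.Membership.Propositional using (_∈_)
open import Data.List.Relation.Unary.Unique.Propositional using (Unique)
open import Data.Nat.Base using (ℕ; suc; _≤_; _<_)
open import Data.Product.Base using (∃-syntax; _×_)
open import Function.Bundles using (_⤖_; _⇔_; module Bijection)
open import Function.Definitions using (Injective; Surjective)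
open import Relation.Binary.Construct.Closure.ReflexiveTransitive using (Star)
open import Relation.Binary.PropositionalEquality.Core using (_≡_)
open import Relation.Nullary.Negation.Core using (¬_)

record Graph (n : ℕ) : Set where
  field
    adj       : Fin n → Fin n → Bool
    symmetric : ∀ u v → T (adj u v) → T (adj v u)
    loopless  : ∀ u → ¬ T (adj u u)

  Adj : Fin n → Fin n → Set
  Adj u v = T (adj u v)

  neighbours : Fin n → List (Fin n)
  neighbours u = filter (λ v → T? (adj u v)) (allFin n)

  degree : Fin n → ℕ
  degree u = length (neighbours u)

  Δ : ℕ
  Δ = max 0 (map degree (allFin n))

  Regular : ℕ → Set
  Regular k = ∀ u → degree u ≡ k

  Connected : Set
  Connected = ∀ u v → Star Adj u v

  -- An edge uv is presented both as e : Adj u v and as its reverse in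
  -- Adj v u; a labelling sends the former to λᵤ(uv), the latter to λᵥ(uv).
  -- The two values are unrelated in general.
  Labelling : Set
  Labelling = ∀ u v → Adj u v → ℕ

  Used : Labelling → ℕ → Set
  Used lab ℓ = ∃[ u ] ∃[ v ] ∃[ e ] lab u v e ≡ ℓ

  UsesExactly : Labelling → ℕ → Set
  UsesExactly lab m =
    ∃[ ls ] Unique ls × (∀ ℓ → ℓ ∈ ls ⇔ Used lab ℓ) × length ls ≡ m

  HasRank : Labelling → Fin n ⤖ Fin n → Set
  HasRank lab ρ = ∀ u v (e : Adj u v) →
    (1 ≤ lab u v e) × (lab u v e < n) ×
    (+ n) ∣ (+ lab u v e - (+ toℕ (r v) - + toℕ (r u)))
    where r = Bijection.to ρ

  IsCSD : Labelling → Set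
  IsCSD lab = ∃[ ρ ] HasRank lab ρ

  IsMCSD : Labelling → Set
  IsMCSD lab = IsCSD lab × UsesExactly lab Δ

  AdmitsMCSD : Set
  AdmitsMCSD = ∃[ lab ] IsMCSD lab

  -- A cycle of length suc m.
  record Cycle (m : ℕ) : Set where
    field
      length≥3 : 3 ≤ suc m
      vertex   : Fin (suc m) → Fin n
      distinct : Injective _≡_ _≡_ vertex
      step     : ∀ (i : Fin m) → Adj (vertex (inject₁ i)) (vertex (suc i))
      close    : Adj (vertex (fromℕ m)) (vertex zero)

  HasHamiltonianCycle : Set
  HasHamiltonianCycle =
    ∃[ m ] ∃[ C ] Surjective _≡_ _≡_ (Cycle.vertex {m} C)

{-# OPTIONS --safe #-}
module Submission where

-- Counting labels at a vertex shows that every label occurs there, so G is a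
-- circulant graph on ℤ/n whose connection set is the set of labels.  The labels
-- are then added one by one.  With d the gcd of n and of the labels used so
-- far, there is a closed walk through the multiples of d modulo n; for a new
-- label s, the translates of this walk by 0, s, …, (d / gcd d s − 1) s lie in
-- distinct cosets, and the product cycle × path they span is traversed by a snake
-- that avoids one column, kept for the way back.  The snake reaches that column
-- in its last row whatever the parities, because the rows are cyclic.
-- Connectedness makes the final gcd 1.

open import Defs
open import Data.Bool.Properties using (T?)
open import Data.Fin.Base using (Fin; zero; suc; inject₁; fromℕ; toℕ; fromℕ<)
open import Data.Fin.Properties using (toℕ-fromℕ<; toℕ-injective; toℕ<n)
open import Data.List.Base using (List; []; _∷_; [_]; _++_; _∷ʳ_; map; reverse; length; lookup; allFin)
open import Data.List.Extrema.Nat using (max≤v⁺)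
open import Data.List.Membership.Propositional using (_∈_)
open import Data.List.Membership.Propositional.Properties using (∈-∃++; ∈-lookup; ∈-map⁺; ∈-filter⁻; ∈-allFin)
open import Data.List.Properties using (length-map; length-++; length-tabulate; unfold-reverse)
open import Data.List.Relation.Binary.Permutation.Propositional using (_↭_; ↭-sym; ↭-trans; prep; ↭⇒↭ₛ)
open import Data.List.Relation.Binary.Permutation.Propositional.Properties
  using (↭-reverse; ∷↭∷ʳ; ↭-length; ∈-resp-↭; shift; All-resp-↭) renaming (map⁺ to ↭-map⁺; ++⁺ to ↭-++⁺; ++⁺ˡ to ↭-++⁺ˡ)
import Data.List.Relation.Binary.Permutation.Setoid.Properties as Permutationₛ
open import Data.List.Relation.Binary.Subset.Propositional using (_⊆_)
open import Data.List.Relation.Unary.All as All using (All; []; _∷_)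
import Data.List.Relation.Unary.All.Properties as All
open import Data.List.Relation.Unary.AllPairs as AllPairs using (AllPairs; []; _∷_)
import Data.List.Relation.Unary.AllPairs.Properties as AllPairs
open import Data.List.Relation.Unary.Any using (here; there; index)
open import Data.List.Relation.Unary.Any.Properties using (lookup-index)
open import Data.List.Relation.Unary.Unique.Propositional using (Unique)
open import Data.List.Relation.Unary.Unique.Propositional.Properties using (filter⁺; allFin⁺)
import Data.Integer.Base as ℤ
open import Data.Integer.Base using (ℤ; +_)
import Data.Integer.Divisibility.Signed as ℤ
import Data.Integer.DivMod as ℤ
import Data.Integer.Properties as ℤ
open import Data.Integer.Tactic.RingSolver using (solve-∀)
open import Data.Nat.Base using (ℕ; zero; suc; _+_; _*_; _≤_; _<_; z≤n; s≤s; NonZero; >-nonZero; z<s; ≢-nonZero; ≢-nonZero⁻¹)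
open import Data.Nat.Divisibility using (_∣_; divides; ∣1⇒≡1; ∣-refl; ∣-trans; >⇒∤; *-cancelʳ-∣)
open import Data.Nat.GCD using (gcd; gcd[m,n]∣m; gcd[m,n]∣n; gcd-greatest; c*gcd[m,n]≡gcd[cm,cn])
open import Data.Nat.Properties
open import Data.Product.Base using (∃-syntax; _×_; _,_; proj₁; proj₂)
open import Data.Sum.Base using (inj₁; inj₂)
open import Function.Base using (id)
open import Function.Bundles using (_⤖_; module Bijection; module Equivalence)
open import Level using (Level)
open import Relation.Binary.Construct.Closure.ReflexiveTransitive using (Star; ε; _◅_)
open import Relation.Binary.Core using (Rel)
open import Relation.Binary.Definitions using (Symmetric)
open import Relation.Binary.PropositionalEquality hiding ([_])
open import Relation.Nullary.Negation using (¬_; contradiction)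
open import Relation.Unary using (Pred)

-- Finite lists: pigeonhole and permutations.

private
  variable
    a p r : Level
    A : Set a
    v : A
    xs ys : List A

-- Pigeonhole by deletion: the head `x` is cut out of `ys`, the rest of `xs` still lies in what
-- remains because `x` does not recur, and both lengths drop by one. It serves twice: every label
-- occurs at every vertex, and the final cycle misses no vertex.
subset-of-unique : Unique xs → xs ⊆ ys → length ys ≤ length xs → ys ⊆ xs
subset-of-unique {ys = []} [] _ _ ()
subset-of-unique {xs = x ∷ xs} {ys} (x∉xs ∷ uniq) xs⊆ys ys≤xs v∈ys
  with zs , zs′ , refl ← ∈-∃++ (xs⊆ys (here refl))
  with ∈-resp-↭ (shift x zs zs′) v∈ys
... | here refl = here refl
... | there v∈ = there (subset-of-unique uniq xs⊆zs zs≤xs v∈)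
  where
  xs⊆zs : xs ⊆ zs ++ zs′
  xs⊆zs y∈xs with ∈-resp-↭ (shift x zs zs′) (xs⊆ys (there y∈xs))
  ... | here refl = contradiction refl (All.lookup x∉xs y∈xs)
  ... | there y∈  = y∈

  zs≤xs : length (zs ++ zs′) ≤ length xs
  zs≤xs = ≤-pred (subst (_≤ suc (length xs)) (↭-length (shift x zs zs′)) ys≤xs)

lookup-injective : Unique xs → ∀ i j → lookup xs i ≡ lookup xs j → i ≡ j
lookup-injective (x∉xs ∷ uniq) zero    zero    _  = refl
lookup-injective (x∉xs ∷ uniq) zero    (suc j) eq = contradiction eq (All.lookup x∉xs (∈-lookup j))
lookup-injective (x∉xs ∷ uniq) (suc i) zero    eq = contradiction (sym eq) (All.lookup x∉xs (∈-lookup i))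
lookup-injective (x∉xs ∷ uniq) (suc i) (suc j) eq = cong suc (lookup-injective uniq i j eq)

AllPairs-resp-↭ : {R : Rel A r} → Symmetric R → xs ↭ ys → AllPairs R xs → AllPairs R ys
AllPairs-resp-↭ {A = A} {R = R} R-sym xs↭ys =
  Permutationₛ.AllPairs-resp-↭ (setoid A) R-sym (resp₂ R) (↭⇒↭ₛ xs↭ys)

-- Walks and their vertex lists.

module _ {A : Set a} where

  -- The list holds every vertex of the walk, both ends included.
  data Walk (E : Rel A r) : A → A → List A → Set (a Level.⊔ r) where
    stop : ∀ {u} → Walk E u u [ u ]
    _∷_  : ∀ {u v w vs} → E u v → Walk E v w vs → Walk E u w (u ∷ vs)

module _ {A : Set a} {E : Rel A r} where

  walk-++ : ∀ {u v w x us ws} → Walk E u v us → E v w → Walk E w x ws → Walk E u x (us ++ ws)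
  walk-++ stop    e q = e ∷ q
  walk-++ (f ∷ p) e q = f ∷ walk-++ p e q

  walk-reverse : Symmetric E → ∀ {u v us} → Walk E u v us → Walk E v u (reverse us)
  walk-reverse E-sym stop = stop
  walk-reverse E-sym {us = u ∷ us} (e ∷ p) =
    subst (Walk E _ _) (sym (unfold-reverse u us)) (walk-++ (walk-reverse E-sym p) (E-sym e) stop)

  -- `lookup ws i` is by definition `lookup (w ∷ ws) (suc i)`, so this has the shape of the field
  -- `step` of `Cycle`.
  walk-step : ∀ {u v w ws} → Walk E u v (w ∷ ws) →
              ∀ (i : Fin (length ws)) → E (lookup (w ∷ ws) (inject₁ i)) (lookup ws i)
  walk-step (e ∷ stop)      zero    = e
  walk-step (e ∷ (_ ∷ _))   zero    = e
  walk-step (_ ∷ p@(_ ∷ _)) (suc i) = walk-step p i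

  walk-start : ∀ {u v w ws} → Walk E u v (w ∷ ws) → u ≡ w
  walk-start stop    = refl
  walk-start (_ ∷ _) = refl

  walk-end : ∀ {u v w ws} → Walk E u v (w ∷ ws) → v ≡ lookup (w ∷ ws) (fromℕ (length ws))
  walk-end stop            = refl
  walk-end (_ ∷ stop)      = refl
  walk-end (_ ∷ p@(_ ∷ _)) = walk-end p

walk-map : ∀ {b s} {B : Set b} {E : Rel A r} {F : Rel B s} (f : A → B) →
           (∀ {u v} → E u v → F (f u) (f v)) →
           ∀ {u v us} → Walk E u v us → Walk F (f u) (f v) (map f us)
walk-map f E⇒F stop    = stop
walk-map f E⇒F (e ∷ p) = E⇒F e ∷ walk-map f E⇒F p

-- Rows of translates and the spiral through them.

module _ {A : Set a} (τ : A → A) where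

  -- The number counts the translates after the first row, so there are `suc m` rows.
  rows : ℕ → List A → List A
  rows zero    xs = xs
  rows (suc m) xs = xs ++ rows m (map τ xs)

  -- Snakes through the rows xs, τ xs, …, τᵐ xs, alternating direction, and
  -- comes back along the column τᵐ x, …, τ x, x.
  spiral : A → List A → ℕ → List A
  spiral x xs zero    = xs ∷ʳ x
  spiral x xs (suc m) = (xs ++ spiral (τ x) (map τ (reverse xs)) m) ∷ʳ x

  rows-↭ : ∀ m → xs ↭ ys → rows m xs ↭ rows m ys
  rows-↭ zero    p = p
  rows-↭ (suc m) p = ↭-++⁺ p (rows-↭ m (↭-map⁺ τ p))

  -- Distinctness, divisibility and size do not depend on the order, so they are established for
  -- `rows` and carried to the spiral along this permutation.
  spiral↭rows : ∀ x xs m → spiral x xs m ↭ rows m (x ∷ xs)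
  spiral↭rows x xs zero    = ↭-sym (∷↭∷ʳ x xs)
  spiral↭rows x xs (suc m) = ↭-trans (↭-sym (∷↭∷ʳ x _)) (prep x (↭-++⁺ˡ xs
    (↭-trans (spiral↭rows (τ x) _ m) (rows-↭ m (prep (τ x) (↭-map⁺ τ (↭-reverse xs)))))))

  length-rows : ∀ m xs → length (rows m xs) ≡ suc m * length xs
  length-rows zero    xs = sym (+-identityʳ (length xs))
  length-rows (suc m) xs = begin
    length (xs ++ rows m (map τ xs))        ≡⟨ length-++ xs ⟩
    length xs + length (rows m (map τ xs))  ≡⟨ cong (λ k → length xs + k) (length-rows m (map τ xs)) ⟩
    length xs + suc m * length (map τ xs)   ≡⟨ cong (λ k → length xs + suc m * k) (length-map τ xs) ⟩
    suc (suc m) * length xs                 ∎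
    where open ≡-Reasoning

  rows-All : {P : Pred A p} → (∀ {x} → P x → P (τ x)) → ∀ m → All P xs → All P (rows m xs)
  rows-All τ-P zero    pxs = pxs
  rows-All τ-P (suc m) pxs = All.++⁺ pxs (rows-All τ-P m (All.map⁺ (All.map τ-P pxs)))

  module _ {E : Rel A r} (E-sym : Symmetric E)
           (τ-E : ∀ {x y} → E x y → E (τ x) (τ y)) (E-τ : ∀ x → E x (τ x)) where

    -- Reversing a row exchanges its ends, so the edges from `x` to both `y` and `z` are carried
    -- along and swapped at each step. Whichever end the snake reaches in the last row is then
    -- adjacent to the column; the way back uses the edges of `τ` reversed.
    spiral-walk : ∀ m {x y z} → Walk E y z xs → E x y → E x z → Walk E y x (spiral x xs m)
    spiral-walk zero    p xy xz = walk-++ p (E-sym xz) stop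
    spiral-walk (suc m) p xy xz = walk-++
      (walk-++ p (E-τ _) (spiral-walk m (walk-map τ τ-E (walk-reverse E-sym p)) (τ-E xz) (τ-E xy)))
      (E-sym (E-τ _)) stop

  module _ {R : Rel A r} (τ-R : ∀ {x y} → R x y → R (τ x) (τ y))
           (Row : ℕ → Pred A p) (τ-Row : ∀ {i x} → Row i x → Row (suc i) (τ x)) where

    rows-Row : ∀ m {i} → All (Row i) xs →
               All (λ x → ∃[ j ] i ≤ j × j ≤ m + i × Row j x) (rows m xs)
    rows-Row zero    pxs = All.map (λ px → _ , ≤-refl , ≤-refl , px) pxs
    rows-Row (suc m) {i} pxs = All.++⁺
      (All.map (λ px → i , ≤-refl , m≤n+m i (suc m) , px) pxs)
      (All.map (λ (j , i<j , j≤ , px) → j , <⇒≤ i<j , ≤-trans j≤ (≤-reflexive (+-suc m i)) , px)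
        (rows-Row m (All.map⁺ (All.map τ-Row pxs))))

    -- Pairs within a row are translates of pairs in the first row; pairs from different rows are
    -- left to the separation hypothesis. The index `i` of the first row is free so that the
    -- induction can pass to the translated rows.
    rows-AllPairs : ∀ m {i} →
      (∀ {j x y} → i ≤ j → ∀ {k} → j < k → k ≤ m + i → Row j x → Row k y → R x y) →
      All (Row i) xs → AllPairs R xs → AllPairs R (rows m xs)
    rows-AllPairs zero    sep pxs rxs = rxs
    rows-AllPairs (suc m) {i} sep pxs rxs = AllPairs.++⁺ rxs
      (rows-AllPairs m
        (λ i<j j<k k≤ → sep (<⇒≤ i<j) j<k (≤-trans k≤ (≤-reflexive (+-suc m i))))
        τpxs (AllPairs.map⁺ (AllPairs.map τ-R rxs)))
      (All.map (λ px → All.map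
          (λ (k , i<k , k≤ , py) → sep ≤-refl i<k (≤-trans k≤ (≤-reflexive (+-suc m i))) px py)
          (rows-Row m τpxs))
        pxs)
      where τpxs = All.map⁺ (All.map τ-Row pxs)

-- Divisibility and congruence modulo `n`.

-- t s and t d are both multiples of d, hence so is t (gcd d s).
multiple-of-cofactor : ∀ d s t q .{{_ : NonZero d}} → d ≡ q * gcd d s → d ∣ t * s → q ∣ t
multiple-of-cofactor d s t q d≡ d∣ts =
  *-cancelʳ-∣ (gcd d s) {{gcd≢0}}
    (subst₂ _∣_ d≡ (sym (c*gcd[m,n]≡gcd[cm,cn] t d s)) (gcd-greatest (divides t refl) d∣ts))
  where
  gcd≢0 : NonZero (gcd d s)
  gcd≢0 = ≢-nonZero λ g≡0 → ≢-nonZero⁻¹ d (trans d≡ (trans (cong (λ g → q * g) g≡0) (*-zeroʳ q)))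

multiple-below : ∀ {n} t → t < n → n ∣ t → t ≡ 0
multiple-below zero    _   _   = refl
multiple-below (suc t) t<n n∣t = contradiction n∣t (>⇒∤ t<n)

congruent-below : ∀ {n a b} → a < n → b < n → + n ℤ.∣ + a ℤ.- + b → a ≡ b
congruent-below {n} {a} {b} a<n b<n n∣a-b with ≤-total a b
... | inj₁ a≤b with t , refl ← m≤n⇒∃[o]m+o≡n a≤b =
  sym (trans (cong (λ k → a + k) (multiple-below t (≤-<-trans (m≤n+m t a) b<n)
    (ℤ.∣⇒∣ᵤ (subst (+ n ℤ.∣_) (lemma (+ a) (+ t)) (ℤ.∣m⇒∣-m n∣a-b))))) (+-identityʳ a))
  where
  lemma : ∀ a t → ℤ.- (a ℤ.- (a ℤ.+ t)) ≡ t
  lemma = solve-∀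
... | inj₂ b≤a with t , refl ← m≤n⇒∃[o]m+o≡n b≤a =
  trans (cong (λ k → b + k) (multiple-below t (≤-<-trans (m≤n+m t b) a<n)
    (ℤ.∣⇒∣ᵤ (subst (+ n ℤ.∣_) (lemma (+ b) (+ t)) n∣a-b)))) (+-identityʳ b)
  where
  lemma : ∀ b t → (b ℤ.+ t) ℤ.- b ≡ t
  lemma = solve-∀

-- Closed walks in a circulant graph.

module Circulant (n : ℕ) .{{_ : NonZero n}} (labels : List ℕ) where

  -- Residues modulo `n` are represented by arbitrary integers, so that translation is plain
  -- addition; congruence replaces equality.
  record E (x y : ℤ) : Set where
    constructor edge
    field
      label      : ℕ
      is-label   : label ∈ labels
      difference : + n ℤ.∣ + label ℤ.- (y ℤ.- x)

  Distinct : Rel ℤ _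
  Distinct x y = ¬ + n ℤ.∣ x ℤ.- y

  -- That all multiples of `d` modulo `n` are visited is encoded by counting: the vertices are
  -- incongruent multiples of `d`, and there are `n / d` of them. Length two is allowed, the closing
  -- edge then retracing the only step.
  record Closed (d : ℕ) : Set where
    field
      vertices  : List ℤ
      first last : ℤ
      walk      : Walk E first last vertices
      close     : E last first
      distinct  : AllPairs Distinct vertices
      multiples : All (+ d ℤ.∣_) vertices
      size      : d * length vertices ≡ n

  nonZero : ∀ {d k} → d * k ≡ n → NonZero d
  nonZero {k = k} dk≡n = ≢-nonZero λ d≡0 → ≢-nonZero⁻¹ n (trans (sym dk≡n) (cong (λ d → d * k) d≡0))

  Distinct-sym : Symmetric Distinct
  Distinct-sym {x} {y} x≢y n∣y-x = x≢y (subst (+ n ℤ.∣_) (lemma x y) (ℤ.∣m⇒∣-m n∣y-x))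
    where
    lemma : ∀ x y → ℤ.- (y ℤ.- x) ≡ x ℤ.- y
    lemma = solve-∀

  -- Translation by one label.

  module Shift (s : ℕ) (s∈labels : s ∈ labels) where

    τ : ℤ → ℤ
    τ x = x ℤ.+ + s

    τ-difference : ∀ x y → y ℤ.- x ≡ τ y ℤ.- τ x
    τ-difference x y = lemma x y (+ s)
      where
      lemma : ∀ x y s → y ℤ.- x ≡ (y ℤ.+ s) ℤ.- (x ℤ.+ s)
      lemma = solve-∀

    τ-E : ∀ {x y} → E x y → E (τ x) (τ y)
    τ-E {x} {y} (edge t t∈ n∣) = edge t t∈ (subst (λ z → + n ℤ.∣ + t ℤ.- z) (τ-difference x y) n∣)

    E-τ : ∀ x → E x (τ x)
    E-τ x = edge s s∈labels (subst (+ n ℤ.∣_) (lemma x (+ s)) (ℤ.divides (+ 0) refl))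
      where
      lemma : ∀ x s → + 0 ≡ s ℤ.- ((x ℤ.+ s) ℤ.- x)
      lemma = solve-∀

    τ-Distinct : ∀ {x y} → Distinct x y → Distinct (τ x) (τ y)
    τ-Distinct {x} {y} = subst (λ z → ¬ + n ℤ.∣ z) (τ-difference y x)

    module _ (d : ℕ) .{{_ : NonZero d}} (d∣n : d ∣ n) where

      -- The coset of `i * s` modulo `d`.
      Row : ℕ → Pred ℤ _
      Row i x = + d ℤ.∣ x ℤ.- + i ℤ.* + s

      Row-0 : ∀ {x} → + d ℤ.∣ x → Row 0 x
      Row-0 {x} = subst (+ d ℤ.∣_) (lemma x (+ s))
        where
        lemma : ∀ x s → x ≡ x ℤ.- + 0 ℤ.* s
        lemma = solve-∀

      τ-Row : ∀ {i x} → Row i x → Row (suc i) (τ x)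
      τ-Row {i} {x} = subst (+ d ℤ.∣_) (lemma x (+ i) (+ s))
        where
        lemma : ∀ x i s → x ℤ.- i ℤ.* s ≡ (x ℤ.+ s) ℤ.- (+ 1 ℤ.+ i) ℤ.* s
        lemma = solve-∀

      -- If `n ∣ x - y` then `d ∣ x - y`, and subtracting the two row conditions leaves
      -- `d ∣ (k - i) * s`. The cofactor `suc m` would then divide `k - i`, which lies between `1`
      -- and `m`.
      row-separation : ∀ {m} → d ≡ suc m * gcd d s →
        ∀ {i x y k} → i < k → k ≤ m → Row i x → Row k y → Distinct x y
      row-separation {m} d≡ {i} {x} {y} {k} i<k k≤m rx ry n∣x-y
        with t , refl ← m≤n⇒∃[o]m+o≡n i<k =
        >⇒∤ (s≤s (≤-trans (s≤s (m≤n+m t i)) k≤m)) (multiple-of-cofactor d s (suc t) (suc m) d≡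
          (ℤ.∣⇒∣ᵤ (subst (+ d ℤ.∣_) eq
            (ℤ.∣m∣n⇒∣m-n (ℤ.∣m∣n⇒∣m-n rx ry) (ℤ.∣-trans (ℤ.∣ᵤ⇒∣ d∣n) n∣x-y)))))
        where
        lemma : ∀ x y i t s →
          ((x ℤ.- i ℤ.* s) ℤ.- (y ℤ.- (+ 1 ℤ.+ i ℤ.+ t) ℤ.* s)) ℤ.- (x ℤ.- y) ≡ (+ 1 ℤ.+ t) ℤ.* s
        lemma = solve-∀
        eq = trans (lemma x y (+ i) (+ t) (+ s)) (sym (ℤ.pos-* (suc t) s))

      module _ {m xs} (d≡ : d ≡ suc m * gcd d s) (dxs : All (+ d ℤ.∣_) xs) where

        rows-distinct : AllPairs Distinct xs → AllPairs Distinct (rows τ m xs)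
        rows-distinct = rows-AllPairs τ
          (λ {x y} → τ-Distinct {x} {y}) Row (λ {i x} → τ-Row {i} {x}) m
          (λ {_ x y} _ i<k k≤m →
            row-separation d≡ {x = x} {y} i<k (≤-trans k≤m (≤-reflexive (+-identityʳ m))))
          (All.map (λ {x} → Row-0 {x}) dxs)

        rows-multiples : All (+ gcd d s ℤ.∣_) (rows τ m xs)
        rows-multiples = rows-All τ (λ g∣x → ℤ.∣m∣n⇒∣m+n g∣x (ℤ.∣ᵤ⇒∣ (gcd[m,n]∣n d s))) m
          (All.map (ℤ.∣-trans (ℤ.∣ᵤ⇒∣ (gcd[m,n]∣m d s))) dxs)

        rows-size : d * length xs ≡ n → gcd d s * length (rows τ m xs) ≡ n
        rows-size size = begin
          gcd d s * length (rows τ m xs)   ≡⟨ cong (λ k → gcd d s * k) (length-rows τ m xs) ⟩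
          gcd d s * (suc m * length xs)    ≡⟨ *-assoc (gcd d s) (suc m) (length xs) ⟨
          gcd d s * suc m * length xs      ≡⟨ cong (λ k → k * length xs) (*-comm (gcd d s) (suc m)) ⟩
          suc m * gcd d s * length xs      ≡⟨ cong (λ k → k * length xs) d≡ ⟨
          d * length xs                    ≡⟨ size ⟩
          n                                ∎
          where open ≡-Reasoning

    cofactor : ∀ d .{{_ : NonZero d}} → ∃[ m ] d ≡ suc m * gcd d s
    cofactor d with gcd[m,n]∣m d s
    ... | divides zero    d≡ = contradiction d≡ (≢-nonZero⁻¹ d)
    ... | divides (suc m) d≡ = m , d≡

    orbit-walk : ∀ m x → Walk E x (x ℤ.+ + m ℤ.* + s) (rows τ m [ x ])
    orbit-walk zero    x = subst (λ y → Walk E x y [ x ]) (lemma x (+ s)) stop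
      where
      lemma : ∀ x s → x ≡ x ℤ.+ + 0 ℤ.* s
      lemma = solve-∀
    orbit-walk (suc m) x = subst (λ y → Walk E x y (x ∷ rows τ m [ τ x ])) (lemma x (+ m) (+ s))
      (E-τ x ∷ orbit-walk m (τ x))
      where
      lemma : ∀ x m s → (x ℤ.+ s) ℤ.+ m ℤ.* s ≡ x ℤ.+ (+ 1 ℤ.+ m) ℤ.* s
      lemma = solve-∀

    -- The orbit of `0` is treated as rows of width one over the modulus `n` itself, so the row
    -- lemmas apply. It closes after `suc m` steps because `n` is `suc m * gcd n s` and the gcd
    -- divides `s`.
    orbit : Closed (gcd n s)
    orbit with m , n≡ ← cofactor n = record
      { walk      = orbit-walk m (+ 0)
      ; close     = edge s s∈labels n∣
      ; distinct  = rows-distinct n ∣-refl {m} n≡ n∣0 ([] ∷ [])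
      ; multiples = rows-multiples n ∣-refl {m} n≡ n∣0
      ; size      = rows-size n ∣-refl {m} n≡ n∣0 (*-identityʳ n)
      }
      where
      n∣0 : All (+ n ℤ.∣_) [ + 0 ]
      n∣0 = ℤ.divides (+ 0) refl ∷ []

      n∣ms : + n ℤ.∣ + suc m ℤ.* + s
      n∣ms with divides q s≡ ← gcd[m,n]∣n n s = subst (+ n ℤ.∣_) (ℤ.pos-* (suc m) s) (ℤ.∣ᵤ⇒∣ (divides q (begin
        suc m * s              ≡⟨ cong (λ k → suc m * k) s≡ ⟩
        suc m * (q * gcd n s)  ≡⟨ *-comm (suc m) (q * gcd n s) ⟩
        q * gcd n s * suc m    ≡⟨ *-assoc q (gcd n s) (suc m) ⟩
        q * (gcd n s * suc m)  ≡⟨ cong (λ k → q * k) (trans (*-comm (gcd n s) (suc m)) (sym n≡)) ⟩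
        q * n                  ∎)))
        where open ≡-Reasoning

      lemma : ∀ m s → (+ 1 ℤ.+ m) ℤ.* s ≡ s ℤ.- (+ 0 ℤ.- (+ 0 ℤ.+ m ℤ.* s))
      lemma = solve-∀

      n∣ = subst (+ n ℤ.∣_) (lemma (+ m) (+ s)) n∣ms

    module _ (E-sym : Symmetric E) (E-irrefl : ∀ {x} → ¬ E x x) where

      extend : ∀ {d} → Closed d → Closed (gcd d s)
      -- With a single vertex the closing edge would be a loop.
      extend {d} record { walk = stop ; close = close } = contradiction close E-irrefl
      extend {d} record { vertices = x ∷ xs ; walk = e ∷ walk ; close = close
                        ; distinct = distinct ; multiples = multiples ; size = size }
        with m , d≡ ← cofactor d {{nonZero size}} = record
        -- The first vertex `x` of the old walk is the column. The spiral runs from the second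
        -- vertex back to `x`, so the old first edge `e` closes it.
        { walk      = spiral-walk τ E-sym τ-E E-τ m walk e (E-sym close)
        ; close     = e
        ; distinct  = AllPairs-resp-↭ (λ {y z} → Distinct-sym {y} {z}) rows↭
                        (rows-distinct d d∣n {m} d≡ multiples distinct)
        ; multiples = All-resp-↭ rows↭ (rows-multiples d d∣n {m} d≡ multiples)
        ; size      = trans (cong (λ k → gcd d s * k) (sym (↭-length rows↭)))
                        (rows-size d d∣n {m} d≡ multiples size)
        }
        where
        d∣n : d ∣ n
        d∣n = divides (suc (length xs)) (trans (sym size) (*-comm d _))

        instance _ = nonZero size

        rows↭ = ↭-sym (spiral↭rows τ x xs m)

  open Shift using (orbit; extend)

  -- Adding the labels one by one.

  closed-walk : Symmetric E → (∀ {x} → ¬ E x x) →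
    ∀ {s ss} → s ∷ ss ⊆ labels → ∃[ d ] All (d ∣_) (s ∷ ss) × Closed d
  closed-walk E-sym E-irrefl {s} {[]} ss⊆ =
    gcd n s , gcd[m,n]∣n n s ∷ [] , orbit s (ss⊆ (here refl))
  closed-walk E-sym E-irrefl {s} {t ∷ ss} ss⊆
    with d , d∣ss , C ← closed-walk E-sym E-irrefl (λ v∈ → ss⊆ (there v∈)) =
    gcd d s , gcd[m,n]∣n d s ∷ All.map (∣-trans (gcd[m,n]∣m d s)) d∣ss ,
    extend s (ss⊆ (here refl)) E-sym E-irrefl C

  -- The hypothesis on common divisors says that `n` and the labels have gcd 1. The `d` reached
  -- divides every label, and it divides `n` by the field `size`.
  generating⇒spanning : Symmetric E → (∀ {x} → ¬ E x x) →
    (∀ {d} → d ∣ n → (∀ {s} → s ∈ labels → d ∣ s) → d ≡ 1) → n ≢ 1 → Closed 1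
  generating⇒spanning E-sym E-irrefl generate n≢1 = from labels id id
    where
    from : ∀ ls → ls ⊆ labels → labels ⊆ ls → Closed 1
    -- Without labels `n` itself is a common divisor, which forces `n ≡ 1`.
    from []       _   ⊆[] = contradiction (generate ∣-refl λ s∈ → contradiction (⊆[] s∈) λ ()) n≢1
    from (s ∷ ss) ls⊆ ⊆ls with d , d∣ls , C ← closed-walk E-sym E-irrefl ls⊆ =
      subst Closed (generate d∣n λ s∈ → All.lookup d∣ls (⊆ls s∈)) C
      where
      d∣n = divides (length (Closed.vertices C)) (trans (sym (Closed.size C)) (*-comm d _))

-- The given graph as a circulant graph.

module ChordalRegular {n k : ℕ} (G : Graph n) (n≥3 : 3 ≤ n) (connected : Graph.Connected G)
                      (regular : Graph.Regular G k) (mcsd : Graph.AdmitsMCSD G) where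
  open Graph G

  label : Labelling
  label = proj₁ mcsd

  ρ : Fin n ⤖ Fin n
  ρ = proj₁ (proj₁ (proj₂ mcsd))

  hasRank : HasRank label ρ
  hasRank = proj₂ (proj₁ (proj₂ mcsd))

  labels : List ℕ
  labels = proj₁ (proj₂ (proj₂ mcsd))

  label∈labels : ∀ {u v} (e : Adj u v) → label u v e ∈ labels
  label∈labels e = Equivalence.from (proj₁ (proj₂ (proj₂ (proj₂ (proj₂ mcsd)))) _) (_ , _ , e , refl)

  n≢0 : NonZero n
  n≢0 = >-nonZero (<-trans z<s n≥3)

  instance _ = n≢0

  open Circulant n labels

  rank : Fin n → ℤ
  rank v = + toℕ (Bijection.to ρ v)

  at : ℤ → Fin n
  at x = Bijection.to⁻ ρ (fromℕ< (ℤ.n%ℕd<d x n))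

  rank-at : ∀ x → + n ℤ.∣ x ℤ.- rank (at x)
  rank-at x = ℤ.divides (x ℤ./ℕ n) (begin
    x ℤ.- rank (at x)                                       ≡⟨ cong (λ r → x ℤ.- + r) eq ⟩
    x ℤ.- + (x ℤ.%ℕ n)                                      ≡⟨ cong (ℤ._- + (x ℤ.%ℕ n)) (ℤ.a≡a%ℕn+[a/ℕn]*n x n) ⟩
    (+ (x ℤ.%ℕ n) ℤ.+ x ℤ./ℕ n ℤ.* + n) ℤ.- + (x ℤ.%ℕ n)    ≡⟨ lemma (+ (x ℤ.%ℕ n)) (x ℤ./ℕ n ℤ.* + n) ⟩
    x ℤ./ℕ n ℤ.* + n                                        ∎)
    where
    open ≡-Reasoning
    eq : toℕ (Bijection.to ρ (at x)) ≡ x ℤ.%ℕ n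
    eq = trans (cong toℕ (proj₂ (Bijection.strictlySurjective ρ _))) (toℕ-fromℕ< (ℤ.n%ℕd<d x n))
    lemma : ∀ a b → (a ℤ.+ b) ℤ.- a ≡ b
    lemma = solve-∀

  rank-injective : ∀ {u v} → + n ℤ.∣ rank u ℤ.- rank v → u ≡ v
  rank-injective {u} {v} n∣ = Bijection.injective ρ (toℕ-injective
    (congruent-below (toℕ<n (Bijection.to ρ u)) (toℕ<n (Bijection.to ρ v)) n∣))

  at-cong : ∀ {x y} → + n ℤ.∣ x ℤ.- y → at x ≡ at y
  at-cong {x} {y} n∣ = rank-injective (subst (+ n ℤ.∣_) (lemma x y (rank (at x)) (rank (at y)))
    (ℤ.∣m∣n⇒∣m+n (ℤ.∣m∣n⇒∣m-n n∣ (rank-at x)) (rank-at y)))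
    where
    lemma : ∀ x y p q → ((x ℤ.- y) ℤ.- (x ℤ.- p)) ℤ.+ (y ℤ.- q) ≡ p ℤ.- q
    lemma = solve-∀

  at-injective : ∀ {x y} → at x ≡ at y → + n ℤ.∣ x ℤ.- y
  at-injective {x} {y} eq = subst (+ n ℤ.∣_) (lemma x y (rank (at x)))
    (ℤ.∣m∣n⇒∣m-n (rank-at x) (subst (λ v → + n ℤ.∣ y ℤ.- rank v) (sym eq) (rank-at y)))
    where
    lemma : ∀ x y p → (x ℤ.- p) ℤ.- (y ℤ.- p) ≡ x ℤ.- y
    lemma = solve-∀

  label-difference : ∀ {u v} (e : Adj u v) → + n ℤ.∣ + label u v e ℤ.- (rank v ℤ.- rank u)
  label-difference e = ℤ.∣ᵤ⇒∣ (proj₂ (proj₂ (hasRank _ _ e)))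

  _⊕_ : Fin n → ℕ → Fin n
  u ⊕ s = at (rank u ℤ.+ + s)

  -- Both sides have rank congruent to `rank u` plus the label. Hence a neighbour is determined by
  -- its label at `u`.
  label-target : ∀ {u v} (e : Adj u v) → v ≡ u ⊕ label u v e
  label-target {u} {v} e = rank-injective
    (subst (+ n ℤ.∣_) (lemma (rank u) (rank v) (+ label u v e) (rank (u ⊕ label u v e)))
      (ℤ.∣m∣n⇒∣m-n (rank-at (rank u ℤ.+ + label u v e)) (label-difference e)))
    where
    lemma : ∀ a b l c → ((a ℤ.+ l) ℤ.- c) ℤ.- (l ℤ.- (b ℤ.- a)) ≡ b ℤ.- c
    lemma = solve-∀

  length-labels≤k : length labels ≤ k
  length-labels≤k = ≤-trans (≤-reflexive (proj₂ (proj₂ (proj₂ (proj₂ (proj₂ mcsd))))))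
    -- `z≤n` accounts for the default value 0 of the maximum.
    (max≤v⁺ z≤n (All.map⁺ (All.universal (λ u → ≤-reflexive (regular u)) (allFin n))))

  -- The k neighbours of u carry k distinct labels, so no label is missing at u.
  Adj-⊕ : ∀ u {s} → s ∈ labels → Adj u (u ⊕ s)
  Adj-⊕ u s∈ = proj₂ (∈-filter⁻ (λ v → T? (adj u v)) {xs = allFin n}
    (subset-of-unique (filter⁺ _ (allFin⁺ n)) neighbours⊆ ⊕-labels≤ (∈-map⁺ (u ⊕_) s∈)))
    where
    neighbours⊆ : neighbours u ⊆ map (u ⊕_) labels
    neighbours⊆ v∈ with e ← proj₂ (∈-filter⁻ (λ v → T? (adj u v)) {xs = allFin n} v∈) =
      subst (_∈ map (u ⊕_) labels) (sym (label-target e)) (∈-map⁺ (u ⊕_) (label∈labels e))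

    ⊕-labels≤ : length (map (u ⊕_) labels) ≤ degree u
    ⊕-labels≤ = subst₂ _≤_ (sym (length-map (u ⊕_) labels)) (sym (regular u)) length-labels≤k

  -- This direction rests on every label occurring at every vertex; the converse only reads off the
  -- label of the given edge.
  E⇒Adj : ∀ {x y} → E x y → Adj (at x) (at y)
  E⇒Adj {x} {y} (edge s s∈ n∣) = subst (Adj (at x))
    (at-cong {rank (at x) ℤ.+ + s} {y} (subst (+ n ℤ.∣_) (lemma x y (+ s) (rank (at x))) (ℤ.∣m∣n⇒∣m-n n∣ (rank-at x))))
    (Adj-⊕ (at x) s∈)
    where
    lemma : ∀ x y s p → (s ℤ.- (y ℤ.- x)) ℤ.- (x ℤ.- p) ≡ (p ℤ.+ s) ℤ.- y
    lemma = solve-∀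

  Adj⇒E : ∀ {x y} → Adj (at x) (at y) → E x y
  Adj⇒E {x} {y} e = edge (label _ _ e) (label∈labels e)
    (subst (+ n ℤ.∣_) (lemma x y (+ label _ _ e) (rank (at x)) (rank (at y)))
      (ℤ.∣m∣n⇒∣m-n (ℤ.∣m∣n⇒∣m+n (label-difference e) (rank-at x)) (rank-at y)))
    where
    lemma : ∀ x y l p q → ((l ℤ.- (q ℤ.- p)) ℤ.+ (x ℤ.- p)) ℤ.- (y ℤ.- q) ≡ l ℤ.- (y ℤ.- x)
    lemma = solve-∀

  -- Inherited from the graph. In terms of labels, their residues are closed under negation modulo
  -- `n`; likewise `E-irrefl` says that no label is divisible by `n`.
  E-sym : Symmetric E
  E-sym e = Adj⇒E (symmetric _ _ (E⇒Adj e))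

  E-irrefl : ∀ {x} → ¬ E x x
  E-irrefl e = loopless _ (E⇒Adj e)

  -- Along an edge the rank changes by a label modulo `n`, hence by a multiple of `d`. A path joins
  -- the vertices whose ranks are congruent to 0 and 1, so `d` divides 1.
  common-divisor : ∀ {d} → d ∣ n → (∀ {s} → s ∈ labels → d ∣ s) → d ≡ 1
  common-divisor {d} d∣n d∣labels = ∣1⇒≡1 (ℤ.∣⇒∣ᵤ (subst (+ d ℤ.∣_)
    (lemma (rank (at (+ 0))) (rank (at (+ 1))))
    (ℤ.∣m∣n⇒∣m-n (ℤ.∣m∣n⇒∣m+n (d∣path (connected (at (+ 0)) (at (+ 1)))) (d∣ (rank-at (+ 1))))
      (d∣ (rank-at (+ 0))))))
    where
    d∣ : ∀ {z} → + n ℤ.∣ z → + d ℤ.∣ z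
    d∣ = ℤ.∣-trans (ℤ.∣ᵤ⇒∣ d∣n)

    lemma : ∀ p q → ((q ℤ.- p) ℤ.+ (+ 1 ℤ.- q)) ℤ.- (+ 0 ℤ.- p) ≡ + 1
    lemma = solve-∀

    lemma₁ : ∀ l z → l ℤ.- (l ℤ.- z) ≡ z
    lemma₁ = solve-∀

    lemma₂ : ∀ a b c → (b ℤ.- a) ℤ.+ (c ℤ.- b) ≡ c ℤ.- a
    lemma₂ = solve-∀

    d∣path : ∀ {u v} → Star Adj u v → + d ℤ.∣ rank v ℤ.- rank u
    d∣path {u} ε = subst (+ d ℤ.∣_) (sym (ℤ.+-inverseʳ (rank u))) (ℤ.divides (+ 0) refl)
    d∣path {u} {w} (_◅_ {j = v} e p) = subst (+ d ℤ.∣_) (lemma₂ (rank u) (rank v) (rank w))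
      (ℤ.∣m∣n⇒∣m+n
        (subst (+ d ℤ.∣_) (lemma₁ (+ label u v e) (rank v ℤ.- rank u))
          (ℤ.∣m∣n⇒∣m-n {m = + label u v e} (ℤ.∣ᵤ⇒∣ (d∣labels (label∈labels e)))
            (d∣ (label-difference e))))
        (d∣path p))

  -- From the spanning closed walk to the Hamiltonian cycle.

  spanning-walk : Closed 1
  spanning-walk = generating⇒spanning E-sym E-irrefl common-divisor
    λ n≡1 → contradiction (subst (3 ≤_) n≡1 n≥3) λ { (s≤s ()) }

  -- For `d = 1` the walk has `n` pairwise incongruent vertices, which `at` sends to distinct
  -- vertices of the graph; by pigeonhole these are all of them. The bound `3 ≤ n` excludes the
  -- degenerate closed walk of length two.
  hamiltonian : Closed 1 → HasHamiltonianCycle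
  hamiltonian record { vertices = [] ; walk = () }
  hamiltonian record { vertices = x ∷ xs ; walk = walk ; close = close ; distinct = distinct ; size = size } =
    length vs , record
      { length≥3 = ≤-trans n≥3 (≤-reflexive (sym length-cycle))
      ; vertex   = lookup (at x ∷ vs)
      ; distinct = lookup-injective unique _ _
      ; step     = walk-step at-walk
      ; close    = subst₂ Adj (walk-end at-walk) (walk-start at-walk) (E⇒Adj close)
      } , λ v → index (covers v) , λ { refl → sym (lookup-index (covers v)) }
    where
    vs = map at xs

    at-walk = walk-map {F = Adj} at E⇒Adj walk

    length-cycle : suc (length vs) ≡ n
    length-cycle = trans (cong suc (length-map at xs)) (trans (sym (*-identityˡ _)) size)

    unique : Unique (at x ∷ vs)
    unique = AllPairs.map⁺ (AllPairs.map (λ {y z} y≢z eq → y≢z (at-injective {y} {z} eq)) distinct)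

    covers : ∀ v → v ∈ at x ∷ vs
    covers v = subset-of-unique {ys = allFin n} unique (λ {u} _ → ∈-allFin u)
      (≤-reflexive (trans (length-tabulate id) (sym length-cycle))) (∈-allFin v)

corollary9 : ∀ (n k : ℕ) (G : Graph n) → 3 ≤ n →
    Graph.Connected G → Graph.Regular G k → Graph.AdmitsMCSD G →
    Graph.HasHamiltonianCycle G
corollary9 n k G n≥3 connected regular mcsd = hamiltonian spanning-walk
  where open ChordalRegular G n≥3 connected regular mcsd
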